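{- Let $\phi$ be a conjunction of xor-clauses in 3-xor normal form with $\mathrm{vars}(\phi)=\{x_1,\dots,x_m\}$. For each pair of distinct indices $i,j$ let $e_{ij}=e_{ji}$ be a new variable (not in $\mathrm{vars}(\phi)$, and distinct for distinct pairs), and let $$\mathrm{Eq}(\phi)=\bigwedge_{(x_i\oplus x_j\oplus x_k\equiv p)\in\phi}(e_{ij}\oplus x_k\oplus\top\equiv p)\wedge(e_{ik}\oplus x_j\oplus\top\equiv p)\wedge(x_i\oplus e_{jk}\oplus\top\equiv p)\ \wedge\bigwedge_{1\le i<j<k\le m}(e_{ij}\oplus e_{jk}\oplus e_{ik}\equiv\top).$$ Then $\mathrm{Eq}(\phi)$ is an EC-simulation formula for $\phi$.
   Context: **Xor-clauses.** An xor-clause is an equation $z_1\oplus\dots\oplus z_k\equiv p$ over distinct propositional variables with $p\in\{\bot,\top\}$ ($\oplus$ is exclusive or); equations are always simplified to normal form by cancelling repeated variables in pairs and moving constants to the right-hand side. The literal $x$ is identified with $(x\equiv\top)$ and $\neg x$ with $(x\equiv\bot)$. The unsatisfiable empty xor-clause is identified with $\bot$. $\mathrm{vars}(\phi)$ is the set of variables of $\phi$ and $\mathrm{lits}(\phi)=\{x,\neg x\mid x\in\mathrm{vars}(\phi)\}$. **3-xor normal form.** $\phi$ is in 3-xor normal form if (i) every xor-clause in it has exactly three variables, and (ii) each pair of distinct xor-clauses in it shares at most one variable. **UP.** $C[x/D]$ is the normal form of the xor-clause obtained from $C$ by replacing $x$ by $D$. Rules: from $(x\equiv\top)$ and an xor-clause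 $C$ infer $C[x/\top]$; from $(x\equiv\bot)$ and $C$ infer $C[x/\bot]$. **EC.** Rules (letters are generic variables; variables in one displayed xor-clause are distinct, $x_1,\dots,x_n$ pairwise distinct, $a,b,c_i,d\in\{\bot,\top\}$): from $(x\equiv\top),(x\equiv\bot)$ infer $\bot$; from $(x\equiv a),(x\oplus y\equiv b)$ infer $(y\equiv a\oplus b)$; from $(x\equiv a),(x\oplus y\oplus z\equiv b)$ infer $(y\oplus z\equiv a\oplus b)$; from $(x_1\oplus x_2\equiv c_1),\dots,(x_{n-1}\oplus x_n\equiv c_{n-1}),(x_1\oplus x_n\oplus y\equiv d)$ infer $(y\equiv c_1\oplus\dots\oplus c_{n-1}\oplus d)$; from $(x_1\oplus x_2\equiv c_1),\dots,(x_{n-1}\oplus x_n\equiv c_{n-1}),(x_n\oplus x_1\equiv c_n)$ with $c_1\oplus\dots\oplus c_n=\top$ infer $\bot$. **Derivability.** For $S\in\{\mathrm{UP},\mathrm{EC}\}$, $D$ is $S$-derivable from $\psi$ if $D$ occurs in a finite sequence of xor-clauses each of which is in $\psi$ or is inferred from earlier ones by a rule of $S$. **EC-simulation formula.** A conjunction $\psi$ of xor-clauses (possibly with variables not in $\phi$) is an EC-simulation formula for $\phi$ if (i) the satisfying truth assignments of $\phi$ are exactly those of $\phi\wedge\psi$ projected to $\mathrm{vars}(\phi)$, and (ii) for all $k\ge 0$, $\tilde l_1,\dots,\tilde l_k\in\mathrm{lits}(\phi)$ and every literal $\hat l$, if $\hat l$ is EC-derivable from $\phi\wedge\tilde l_1\wedge\dots\wedge\tilde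 l_k$, then $\hat l$ is UP-derivable from $(\phi\wedge\psi)\wedge\tilde l_1\wedge\dots\wedge\tilde l_k$. -}

module Defs where

open import Data.Bool using (Bool; true; false; _xor_)
import Data.Bool.Properties as Bool
open import Data.Fin using (Fin; zero; suc; inject₁; fromℕ; _<?_)
open import Data.List using (List; []; _∷_; [_]; _++_; map; concatMap; filter; foldr; length; allFin; cartesianProduct)
open import Data.List.Membership.Propositional using (_∈_)
import Data.List.Membership.DecPropositional as DecMembership
open import Data.List.Relation.Binary.BagAndSetEquality using (_∼[_]_; set)
open import Data.List.Relation.Unary.All as All using (All)
open import Data.List.Relation.Unary.All.Properties using (¬Any⇒All¬)
open import Data.List.Relation.Unary.Any as Any using (Any)
open import Data.List.Relation.Unary.Unique.Propositional using (Unique; []; _∷_)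
open import Data.List.Relation.Unary.Unique.Propositional.Properties using (filter⁺)
open import Data.Nat using (ℕ; suc)
open import Data.Product using (∃-syntax; _×_; _,_)
open import Data.Sum using (_⊎_)
open import Data.Vec.Functional as Vector using (Vector)
open import Function.Base using (_∘_)
open import Function.Bundles using (_⇔_; mk⇔; Equivalence)
open import Function.Definitions using (Injective)
open import Relation.Binary.Definitions using (DecidableEquality)
open import Relation.Binary.PropositionalEquality using (_≡_)
open import Relation.Nullary using (¬_; Dec; yes; no; ¬?; _×-dec_)
open import Relation.Nullary.Decidable using (map′)

-- The truth values ⊥ and ⊤ are false and true.
module XorLogic {V : Set} (_≟_ : DecidableEquality V) where

  open DecMembership _≟_ using (_∈?_)

  record XorClause : Set where
    constructor mkXor
    field
      vars   : List V
      unique : Unique vars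
      rhs    : Bool

  open XorClause public

  -- Equality of xor-clauses: the order in which the variables are listed is
  -- immaterial.
  infix 4 _≈_ _≈?_ _∈ᶠ_ _∈ᶠ?_

  _≈_ : XorClause → XorClause → Set
  C ≈ D = vars C ∼[ set ] vars D × rhs C ≡ rhs D

  _≈?_ : (C D : XorClause) → Dec (C ≈ D)
  C ≈? D = set? (vars C) (vars D) ×-dec (rhs C Bool.≟ rhs D)
    where
    set? : (xs ys : List V) → Dec (xs ∼[ set ] ys)
    set? xs ys = map′
      (λ (p , q) → mk⇔ (All.lookup p) (All.lookup q))
      (λ e → All.tabulate (Equivalence.to e) , All.tabulate (Equivalence.from e))
      (All.all? (_∈? ys) xs ×-dec All.all? (_∈? xs) ys)

  -- A formula is the conjunction of the listed xor-clauses.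
  Formula : Set
  Formula = List XorClause

  _∈ᶠ_ : XorClause → Formula → Set
  C ∈ᶠ φ = Any (C ≈_) φ

  _∈ᶠ?_ : (C : XorClause) (φ : Formula) → Dec (C ∈ᶠ φ)
  C ∈ᶠ? φ = Any.any? (C ≈?_) φ

  varsᶠ : Formula → List V
  varsᶠ = concatMap vars

  data Term : Set where
    var : V → Term
    con : Bool → Term

  cancel : V → List V → List V
  cancel x xs with x ∈? xs
  ... | yes _ = filter (¬? ∘ (x ≟_)) xs
  ... | no  _ = x ∷ xs

  cancel-unique : ∀ x {xs} → Unique xs → Unique (cancel x xs)
  cancel-unique x {xs} u with x ∈? xs
  ... | yes _   = filter⁺ (¬? ∘ (x ≟_)) u
  ... | no x∉xs = ¬Any⇒All¬ xs x∉xs ∷ u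

  -- ts ≐ p is the normal form of the equation t₁ ⊕ … ⊕ tₙ ≡ p.
  infix 4 _≐_

  _≐_ : List Term → Bool → XorClause
  []           ≐ p = mkXor [] [] p
  (var x ∷ ts) ≐ p = mkXor (cancel x (vars C)) (cancel-unique x (unique C)) (rhs C)
    where C = ts ≐ p
  (con b ∷ ts) ≐ p = mkXor (vars C) (unique C) (b xor rhs C)
    where C = ts ≐ p

  ⊥ᶜ : XorClause
  ⊥ᶜ = [] ≐ true

  _[_/_] : XorClause → V → List Term → XorClause
  C [ x / ts ] = concatMap replace (vars C) ≐ rhs C
    where
    replace : V → List Term
    replace y with x ≟ y
    ... | yes _ = ts
    ... | no  _ = [ var y ]

  -- (x , true) is the literal x, and (x , false) is ¬x.
  Literal : Set
  Literal = V × Bool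

  lit : Literal → XorClause
  lit (x , b) = [ var x ] ≐ b

  _∈lits_ : Literal → Formula → Set
  (x , _) ∈lits φ = x ∈ varsᶠ φ

  Assignment : Set
  Assignment = V → Bool

  ⨁ : List Bool → Bool
  ⨁ = foldr _xor_ false

  infix 4 _⊨_ _⊨ᶠ_

  _⊨_ : Assignment → XorClause → Set
  τ ⊨ C = ⨁ (map τ (vars C)) ≡ rhs C

  _⊨ᶠ_ : Assignment → Formula → Set
  τ ⊨ᶠ φ = All (τ ⊨_) φ

  record 3XorNF (φ : Formula) : Set where
    field
      three-vars : ∀ {C} → C ∈ᶠ φ → length (vars C) ≡ 3
      share-at-most-one :
        ∀ {C D} → C ∈ᶠ φ → D ∈ᶠ φ → ¬ (C ≈ D) →
        ∀ {x y} → x ∈ vars C → x ∈ vars D → y ∈ vars C → y ∈ vars D → x ≡ y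

  -- The xor-clause x₁ ⊕ … ⊕ xₙ ≡ p, with x₁, …, xₙ distinct, occurs in Γ.
  Displayed : List XorClause → List V → Bool → Set
  Displayed Γ xs p = Unique xs × (map var xs ≐ p) ∈ᶠ Γ

  System : Set₁
  System = List XorClause → XorClause → Set

  data UP (Γ : List XorClause) : XorClause → Set where
    unit-⊤ : ∀ {x C} → lit (x , true)  ∈ᶠ Γ → C ∈ᶠ Γ → UP Γ (C [ x / [ con true ] ])
    unit-⊥ : ∀ {x C} → lit (x , false) ∈ᶠ Γ → C ∈ᶠ Γ → UP Γ (C [ x / [ con false ] ])

  -- In the last two rules the path x₁, …, xₙ is x zero, …, x (fromℕ k) with
  -- n = suc k; k = 0 is ruled out because the variables of the clause closing
  -- the path are distinct.
  data EC (Γ : List XorClause) : XorClause → Set where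
    conflict :
      ∀ {x} → lit (x , true) ∈ᶠ Γ → lit (x , false) ∈ᶠ Γ → EC Γ ⊥ᶜ
    unit₂ :
      ∀ {x y a b} → lit (x , a) ∈ᶠ Γ → Displayed Γ (x ∷ y ∷ []) b →
      EC Γ (lit (y , a xor b))
    unit₃ :
      ∀ {x y z a b} → lit (x , a) ∈ᶠ Γ → Displayed Γ (x ∷ y ∷ z ∷ []) b →
      EC Γ (var y ∷ var z ∷ [] ≐ a xor b)
    eqv-imply :
      ∀ {k} (x : Vector V (suc k)) (c : Vector Bool k) {y d} →
      Injective _≡_ _≡_ x →
      (∀ i → Displayed Γ (x (inject₁ i) ∷ x (suc i) ∷ []) (c i)) →
      Displayed Γ (x zero ∷ x (fromℕ k) ∷ y ∷ []) d →
      EC Γ (lit (y , ⨁ (Vector.toList c) xor d))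
    eqv-conflict :
      ∀ {k} (x : Vector V (suc k)) (c : Vector Bool k) {cₙ} →
      Injective _≡_ _≡_ x →
      (∀ i → Displayed Γ (x (inject₁ i) ∷ x (suc i) ∷ []) (c i)) →
      Displayed Γ (x (fromℕ k) ∷ x zero ∷ []) cₙ →
      ⨁ (Vector.toList c) xor cₙ ≡ true →
      EC Γ ⊥ᶜ

  -- Derivation sequences, latest xor-clause first.
  data Derivation (S : System) (ψ : Formula) : List XorClause → Set where
    []  : Derivation S ψ []
    _∷_ : ∀ {C Γ} → C ∈ᶠ ψ ⊎ S Γ C → Derivation S ψ Γ → Derivation S ψ (C ∷ Γ)

  Derivable : System → Formula → XorClause → Set
  Derivable S ψ D = ∃[ Γ ] (Derivation S ψ Γ × D ∈ᶠ Γ)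

  record ECSimulation (φ ψ : Formula) : Set where
    field
      same-models :
        ∀ (τ : Assignment) →
        τ ⊨ᶠ φ ⇔ (∃[ τ′ ] (τ′ ⊨ᶠ φ ++ ψ × (∀ x → x ∈ varsᶠ φ → τ′ x ≡ τ x)))
      simulates :
        ∀ (ls : List Literal) → All (_∈lits φ) ls → ∀ (l̂ : Literal) →
        Derivable EC (φ ++ map lit ls) (lit l̂) →
        Derivable UP ((φ ++ ψ) ++ map lit ls) (lit l̂)

  record EnumeratesVars {m : ℕ} (x : Fin m → V) (φ : Formula) : Set where
    field
      injective : Injective _≡_ _≡_ x
      vars≡     : ∀ v → v ∈ varsᶠ φ ⇔ (∃[ i ] v ≡ x i)

  -- The values e i i are left unconstrained; Eq does not use them.
  record FreshPairVars {m : ℕ} (e : Fin m → Fin m → V) (φ : Formula) : Set where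
    field
      symmetric : ∀ {i j} → ¬ i ≡ j → e i j ≡ e j i
      new       : ∀ {i j} → ¬ i ≡ j → ¬ e i j ∈ varsᶠ φ
      distinct  : ∀ {i j k l} → ¬ i ≡ j → ¬ k ≡ l → e i j ≡ e k l →
                  (i ≡ k × j ≡ l) ⊎ (i ≡ l × j ≡ k)

  triples : (m : ℕ) → List (Fin m × Fin m × Fin m)
  triples m = filter (λ (i , j , k) → (i <? j) ×-dec (j <? k))
    (cartesianProduct (allFin m) (cartesianProduct (allFin m) (allFin m)))

  -- Each xor-clause of φ is visited through its variables x i, x j, x k with
  -- i < j < k; the three conjuncts it contributes do not depend on that order.
  Eq : {m : ℕ} → (Fin m → V) → (Fin m → Fin m → V) → Formula → Formula
  Eq {m} x e φ =
    concatMap fromClause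
      (filter (λ ((i , j , k) , p) → (var (x i) ∷ var (x j) ∷ var (x k) ∷ [] ≐ p) ∈ᶠ? φ)
        (cartesianProduct (triples m) (false ∷ true ∷ [])))
    ++ map transitivity (triples m)
    where
    fromClause : (Fin m × Fin m × Fin m) × Bool → Formula
    fromClause ((i , j , k) , p) =
      (var (e i j) ∷ var (x k) ∷ con true ∷ [] ≐ p) ∷
      (var (e i k) ∷ var (x j) ∷ con true ∷ [] ≐ p) ∷
      (var (x i) ∷ var (e j k) ∷ con true ∷ [] ≐ p) ∷ []

    transitivity : Fin m × Fin m × Fin m → XorClause
    transitivity (i , j , k) = var (e i j) ∷ var (e j k) ∷ var (e i k) ∷ [] ≐ true

{-# OPTIONS --safe #-}
module Submission where

-- The variable e i j stands for the truth value of x i ≡ x j, so every model of φ extends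
-- to one of Eq φ.  For the simulation, each clause of an EC derivation is one of φ, or is
-- empty, or is a UP-derivable literal, or is an equation x i ⊕ x j ≡ p for which the literal
-- e i j ≡ ¬p is UP-derivable as well.  A path of such equations is collapsed edge by edge
-- through the transitivity clauses, and the literal on e obtained for its two ends meets
-- the clause closing the path in a defining clause of that e.

open import Defs
open import Algebra.Bundles using (CommutativeRing)
open import Data.Bool using (Bool; true; false; not; _xor_)
open import Data.Bool.Properties using (not-distribʳ-xor; xor-annihilates-not; xor-comm; xor-identityʳ; xor-∧-commutativeRing)
open import Data.Bool.Solver using (module xor-∧-Solver)
open import Data.Fin using (Fin; zero; suc; inject₁; fromℕ; _<_; _<?_)
import Data.Fin.Properties as Fin
open import Data.List using (List; []; _∷_; [_]; _++_; map; concatMap; filter; length; allFin; cartesianProduct)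
open import Data.List.Membership.Propositional using (_∈_; _∉_; find; lose)
open import Data.List.Membership.Propositional.Properties using (∈-filter⁺; ∈-filter⁻; ∈-map⁺; ∈-map⁻; ∈-++⁺ˡ; ∈-++⁺ʳ; ∈-concatMap⁺; ∈-cartesianProduct⁺; ∈-cartesianProduct⁻; ∈-allFin)
open import Data.List.Membership.Propositional.Properties.WithK using (unique∧set⇒bag)
open import Data.List.Properties using (map-cong-local)
open import Data.List.Relation.Binary.BagAndSetEquality using (_∼[_]_; set; [_]-Equality; bag-=⇒; ↭⇒∼bag; ∼bag⇒↭)
open import Data.List.Relation.Binary.Permutation.Propositional using (_↭_; ↭⇒↭ₛ; prep; swap; ↭-refl)
open import Data.List.Relation.Binary.Permutation.Propositional.Properties using (↭-length; map⁺; ↭-reverse; shift)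
import Data.List.Relation.Binary.Permutation.Setoid.Properties as Permutationₛ
open import Data.List.Relation.Unary.All as All using (All; []; _∷_)
import Data.List.Relation.Unary.All.Properties as All
import Data.List.Relation.Unary.AllPairs as AllPairs
open import Data.List.Relation.Unary.Any as Any using (Any; here; there)
import Data.List.Relation.Unary.Any.Properties as Any
open import Data.List.Relation.Unary.Unique.Propositional using (Unique; []; _∷_)
open import Data.Nat using (ℕ; suc)
open import Data.Product using (∃-syntax; _×_; _,_; proj₁; proj₂)
open import Data.Sum using (inj₁; inj₂; [_,_]′)
open import Data.Vec.Functional as Vector using (Vector)
open import Function.Base using (_∘_; case_of_)
open import Function.Bundles using (_⇔_; mk⇔; Equivalence)
open import Function.Definitions using (Injective)
open import Relation.Binary.Bundles using (Setoid)
open import Relation.Binary.Definitions using (DecidableEquality; tri<; tri≈; tri>)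
open import Relation.Binary.PropositionalEquality using (_≡_; _≢_; refl; sym; trans; cong; subst; ≢-sym; setoid)
open import Relation.Nullary using (¬?; yes; no; contradiction; _×-dec_)

-- Duplicate-free lists and orderings of three indices.

↭⇒∼set : ∀ {A : Set} {xs ys : List A} → xs ↭ ys → xs ∼[ set ] ys
↭⇒∼set = bag-=⇒ ∘ ↭⇒∼bag

unique∧set⇒↭ : ∀ {A : Set} {xs ys : List A} → Unique xs → Unique ys → xs ∼[ set ] ys → xs ↭ ys
unique∧set⇒↭ u v eq = ∼bag⇒↭ (unique∧set⇒bag u v eq)

unique₂ : ∀ {A : Set} {a b : A} → a ≢ b → Unique (a ∷ b ∷ [])
unique₂ a≢b = (a≢b ∷ []) ∷ [] ∷ []

unique₃ : ∀ {A : Set} {a b c : A} → a ≢ b → a ≢ c → b ≢ c → Unique (a ∷ b ∷ c ∷ [])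
unique₃ a≢b a≢c b≢c = (a≢b ∷ a≢c ∷ []) ∷ unique₂ b≢c

unique-rotate : ∀ {A : Set} {a b c : A} → Unique (a ∷ b ∷ c ∷ []) → Unique (b ∷ c ∷ a ∷ [])
unique-rotate ((a≢b ∷ a≢c ∷ []) ∷ (b≢c ∷ []) ∷ _) = unique₃ b≢c (≢-sym a≢b) (≢-sym a≢c)

-- The two adjacent transpositions generate all permutations of three indices, so sorting reduces to
-- the increasing case. This bridges to `Eq`, which visits increasing triples only.
reorder-increasing : ∀ {m} (Q : Fin m → Fin m → Fin m → Set) →
  (∀ {i j k} → Q i j k → Q j i k) → (∀ {i j k} → Q i j k → Q i k j) →
  (∀ {i j k} → i < j → j < k → Q i j k) →
  ∀ {i j k} → i ≢ j → i ≢ k → j ≢ k → Q i j k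
reorder-increasing Q swap₁₂ swap₂₃ inc {i} {j} {k} i≢j i≢k j≢k
  with Fin.<-cmp i j | Fin.<-cmp i k | Fin.<-cmp j k
... | tri≈ _ i≡j _ | _            | _            = contradiction i≡j i≢j
... | _            | tri≈ _ i≡k _ | _            = contradiction i≡k i≢k
... | _            | _            | tri≈ _ j≡k _ = contradiction j≡k j≢k
... | tri< i<j _ _ | _            | tri< j<k _ _ = inc i<j j<k
... | tri< _ _ _   | tri< i<k _ _ | tri> _ _ k<j = swap₂₃ (inc i<k k<j)
... | tri< i<j _ _ | tri> _ _ k<i | tri> _ _ _   = swap₂₃ (swap₁₂ (inc k<i i<j))
... | tri> _ _ j<i | tri< i<k _ _ | _            = swap₁₂ (inc j<i i<k)
... | tri> _ _ _   | tri> _ _ k<i | tri< j<k _ _ = swap₁₂ (swap₂₃ (inc j<k k<i))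
... | tri> _ _ j<i | tri> _ _ _   | tri> _ _ k<j = swap₁₂ (swap₂₃ (swap₁₂ (inc k<j j<i)))

-- Normal forms and substitution of constants.

module Clauses {V : Set} (_≟_ : DecidableEquality V) where

  open XorLogic _≟_
  open import Data.List.Membership.DecPropositional _≟_ using (_∈?_)

  cancel-∉ : ∀ {x xs} → x ∉ xs → cancel x xs ≡ x ∷ xs
  cancel-∉ {x} {xs} x∉xs with x ∈? xs
  ... | yes x∈xs = contradiction x∈xs x∉xs
  ... | no  _    = refl

  -- On distinct variables `cancel` only ever conses, and the constants affect the right-hand side
  -- alone.
  vars-≐ : ∀ {xs} bs p → Unique xs → vars (map var xs ++ map con bs ≐ p) ≡ xs
  vars-≐ []       p []       = refl
  vars-≐ (_ ∷ bs) p []       = vars-≐ bs p []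
  vars-≐ bs       p (x∉ ∷ u) = trans (cong (cancel _) (vars-≐ bs p u)) (cancel-∉ (All.All¬⇒¬Any x∉))

  ⨁-↭ : ∀ {bs cs} → bs ↭ cs → ⨁ bs ≡ ⨁ cs
  ⨁-↭ = Permutationₛ.foldr-commMonoid (setoid Bool) +-isCommutativeMonoid ∘ ↭⇒↭ₛ
    where open CommutativeRing xor-∧-commutativeRing using (+-isCommutativeMonoid)

  module _ {x : V} {b : Bool} (f : V → List Term)
    (f-≡ : ∀ {y} → x ≡ y → f y ≡ [ con b ]) (f-≢ : ∀ {y} → x ≢ y → f y ≡ [ var y ]) where

    private
      others : List V → List V
      others = filter (¬? ∘ (x ≟_))

    -- The surviving variables stay distinct, so no further cancellation takes place after the
    -- replacement.
    vars-replaced : ∀ {ys} p → Unique ys → vars (concatMap f ys ≐ p) ≡ others ys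
    vars-replaced p [] = refl
    vars-replaced {y ∷ ys} p (y∉ ∷ u) with x ≟ y
    ... | yes x≡y rewrite f-≡ x≡y = vars-replaced p u
    ... | no  x≢y rewrite f-≢ x≢y =
      trans (cong (cancel y) (vars-replaced p u))
            (cancel-∉ (All.All¬⇒¬Any y∉ ∘ proj₁ ∘ ∈-filter⁻ (¬? ∘ (x ≟_))))

    rhs-untouched : ∀ {ys} p → x ∉ ys → rhs (concatMap f ys ≐ p) ≡ p
    rhs-untouched {[]}     p x∉ = refl
    rhs-untouched {y ∷ ys} p x∉ rewrite f-≢ (x∉ ∘ here) = rhs-untouched p (x∉ ∘ there)

    -- In a duplicate-free list `x` occurs exactly once, so `b` is added exactly once.
    rhs-replaced : ∀ {ys} p → Unique ys → x ∈ ys → rhs (concatMap f ys ≐ p) ≡ b xor p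
    rhs-replaced p (y∉ ∷ u) (here x≡y) rewrite f-≡ x≡y =
      cong (b xor_) (rhs-untouched p λ x∈ → All.All¬⇒¬Any y∉ (subst (_∈ _) x≡y x∈))
    rhs-replaced p (y∉ ∷ u) (there x∈) rewrite f-≢ (λ x≡y → All.All¬⇒¬Any y∉ (subst (_∈ _) x≡y x∈)) =
      rhs-replaced p u x∈

  -- The substitution function inside _[_/_] is local to it; unification recovers it.
  module _ (C : XorClause) (x : V) (ts : List Term) where

    private
      function : ∀ {f : V → List Term} → C [ x / ts ] ≡ (concatMap f (vars C) ≐ rhs C) → V → List Term
      function {f} _ = f

    replacement : V → List Term
    replacement = function refl

    replacement-≡ : ∀ {y} → x ≡ y → replacement y ≡ ts
    replacement-≡ {y} x≡y with x ≟ y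
    ... | yes _   = refl
    ... | no  x≢y = contradiction x≡y x≢y

    replacement-≢ : ∀ {y} → x ≢ y → replacement y ≡ [ var y ]
    replacement-≢ {y} x≢y with x ≟ y
    ... | yes x≡y = contradiction x≡y x≢y
    ... | no  _   = refl

  module _ (C : XorClause) (x : V) (b : Bool) where

    vars-[/] : vars (C [ x / [ con b ] ]) ≡ filter (¬? ∘ (x ≟_)) (vars C)
    vars-[/] = vars-replaced (replacement C x _) (replacement-≡ C x _) (replacement-≢ C x _) (rhs C) (unique C)

    rhs-[/] : x ∈ vars C → rhs (C [ x / [ con b ] ]) ≡ b xor rhs C
    rhs-[/] = rhs-replaced (replacement C x _) (replacement-≡ C x _) (replacement-≢ C x _) (rhs C) (unique C)

  -- Clauses up to the order of their variables.

  open Setoid ([ set ]-Equality V) public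
    using () renaming (refl to ∼-refl; trans to ∼-trans; reflexive to ∼-reflexive)

  -- A form of `_∈ᶠ_` that carries no uniqueness proof, so a clause can be addressed by any listing
  -- of its variables. `Occurs (vars C) (rhs C) Γ` unfolds to `C ∈ᶠ Γ`.
  Occurs : List V → Bool → List XorClause → Set
  Occurs xs p Γ = Any (λ C → xs ∼[ set ] vars C × p ≡ rhs C) Γ

  occurs-resp : ∀ {xs ys p Γ} → ys ∼[ set ] xs → Occurs xs p Γ → Occurs ys p Γ
  occurs-resp ys∼xs = Any.map λ (xs∼C , p≡) → ∼-trans ys∼xs xs∼C , p≡

  ∈⇒∈ᶠ : ∀ {C Γ} → C ∈ Γ → C ∈ᶠ Γ
  ∈⇒∈ᶠ = Any.map λ { refl → ∼-refl , refl }

  -- Duplicate-free lists with the same elements are permutations of each other, and exclusive or is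
  -- commutative.
  ⊨-occurs : ∀ {τ φ xs p} → Unique xs → τ ⊨ᶠ φ → Occurs xs p φ → ⨁ (map τ xs) ≡ p
  ⊨-occurs {τ} u τ⊨ o with find o
  ... | C , C∈ , xs∼C , refl = trans (⨁-↭ (map⁺ τ (unique∧set⇒↭ u (unique C) xs∼C))) (All.lookup τ⊨ C∈)

  ⊨-≐ : ∀ {τ xs} bs p {q} → Unique xs → ⨁ (map τ xs) ≡ q →
        ⨁ (map τ (vars (map var xs ++ map con bs ≐ p))) ≡ q
  ⊨-≐ {τ} bs p u = trans (cong (⨁ ∘ map τ) (vars-≐ bs p u))

  UP-weakenˡ : ∀ {Γ Δ C} → UP Γ C → UP (Γ ++ Δ) C
  UP-weakenˡ (unit-⊤ {x} {C} l c) = unit-⊤ {x = x} {C} (Any.++⁺ˡ l) (Any.++⁺ˡ c)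
  UP-weakenˡ (unit-⊥ {x} {C} l c) = unit-⊥ {x = x} {C} (Any.++⁺ˡ l) (Any.++⁺ˡ c)

  -- Unit propagation from a fixed formula.

  module UnitPropagation (Φ : Formula) where

    U : List V → Bool → Set
    U xs p = ∃[ Γ ] (Derivation UP Φ Γ × Occurs xs p Γ)

    -- Sequences list the latest clause first, so `Δ` is derived before `Γ`, and each rule
    -- application in `Γ` is weakened to the longer context.
    _++ᴰ_ : ∀ {Γ Δ} → Derivation UP Φ Γ → Derivation UP Φ Δ → Derivation UP Φ (Γ ++ Δ)
    []           ++ᴰ d′ = d′
    (inj₁ C∈ ∷ d) ++ᴰ d′ = inj₁ C∈ ∷ (d ++ᴰ d′)
    (inj₂ r  ∷ d) ++ᴰ d′ = inj₂ (UP-weakenˡ r) ∷ (d ++ᴰ d′)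

    U-resp : ∀ {xs ys p} → ys ∼[ set ] xs → U xs p → U ys p
    U-resp ys∼xs (Γ , d , o) = Γ , d , occurs-resp ys∼xs o

    U-axiom : ∀ {xs p} → Occurs xs p Φ → U xs p
    U-axiom o with find o
    ... | C , C∈ , xs∼C , p≡ = [ C ] , inj₁ (∈⇒∈ᶠ C∈) ∷ [] , here (xs∼C , p≡)

    U-clause : ∀ {C xs} → C ∈ Φ → vars C ≡ xs → U xs (rhs C)
    U-clause C∈ refl = U-axiom (∈⇒∈ᶠ C∈)

    -- A single UP step in the form used throughout. Since `v` is not in `ys`, erasing it from the
    -- clause leaves exactly `ys`.
    propagate : ∀ {v ys a p} → v ∉ ys → U [ v ] a → U (v ∷ ys) p → U ys (a xor p)
    propagate {v} {ys} {a} v∉ (Γ , d , l) (Δ , d′ , o) with find o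
    ... | C , C∈ , vys∼C , refl =
      C [ v / [ con a ] ] ∷ Γ ++ Δ ,
      inj₂ (rule C a (Any.++⁺ˡ l) (Any.++⁺ʳ Γ (∈⇒∈ᶠ C∈))) ∷ (d ++ᴰ d′) ,
      here (∼-trans ys∼ (∼-reflexive (sym (vars-[/] C v a))) , sym (rhs-[/] C v a (Equivalence.to vys∼C (here refl))))
      where
      rule : ∀ {Γ} C a → lit (v , a) ∈ᶠ Γ → C ∈ᶠ Γ → UP Γ (C [ v / [ con a ] ])
      rule C true  = unit-⊤ {C = C}
      rule C false = unit-⊥ {C = C}

      ys∼ : ys ∼[ set ] filter (¬? ∘ (v ≟_)) (vars C)
      ys∼ = mk⇔
        (λ y∈ → ∈-filter⁺ (¬? ∘ (v ≟_)) (Equivalence.to vys∼C (there y∈)) λ { refl → v∉ y∈ })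
        (λ y∈ → let y∈C , v≢y = ∈-filter⁻ (¬? ∘ (v ≟_)) y∈ in
                case Equivalence.from vys∼C y∈C of λ
                  { (here y≡v) → contradiction (sym y≡v) v≢y ; (there y∈ys) → y∈ys })

-- Original variables, pair variables and the clauses of `Eq`.

module Simulation {V : Set} (_≟_ : DecidableEquality V)
  (φ : XorLogic.Formula _≟_) (nf : XorLogic.3XorNF _≟_ φ)
  {m : ℕ} (x : Fin m → V) (enum : XorLogic.EnumeratesVars _≟_ x φ)
  (e : Fin m → Fin m → V) (fresh : XorLogic.FreshPairVars _≟_ e φ) where

  open XorLogic _≟_
  open Clauses _≟_
  open import Data.List.Membership.DecPropositional _≟_ using (_∈?_)
  open 3XorNF nf
  open EnumeratesVars enum
  open FreshPairVars fresh

  occurs-vars : ∀ {xs p v} → Occurs xs p φ → v ∈ xs → v ∈ varsᶠ φ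
  occurs-vars o v∈ = ∈-concatMap⁺ vars (Any.map (λ (xs∼C , _) → Equivalence.to xs∼C v∈) o)

  index : ∀ {v} → v ∈ varsᶠ φ → ∃[ i ] v ≡ x i
  index = Equivalence.to (vars≡ _)

  x∈ : ∀ i → x i ∈ varsᶠ φ
  x∈ i = Equivalence.from (vars≡ _) (i , refl)

  x-≢ : ∀ {i j} → i ≢ j → x i ≢ x j
  x-≢ i≢j = i≢j ∘ injective

  e-sym : ∀ i j → e i j ≡ e j i
  e-sym i j with i Fin.≟ j
  ... | yes refl = refl
  ... | no  i≢j  = symmetric i≢j

  e≢x : ∀ {i j k} → i ≢ j → e i j ≢ x k
  e≢x {k = k} i≢j eq = new i≢j (subst (_∈ varsᶠ φ) (sym eq) (x∈ k))

  unique-ex : ∀ {i j k} → i ≢ j → Unique (e i j ∷ x k ∷ [])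
  unique-ex i≢j = unique₂ (e≢x i≢j)

  unique-xe : ∀ {i j k} → i ≢ j → Unique (x k ∷ e i j ∷ [])
  unique-xe i≢j = unique₂ (e≢x i≢j ∘ sym)

  unique-xxx : ∀ {i j k} → i ≢ j → i ≢ k → j ≢ k → Unique (x i ∷ x j ∷ x k ∷ [])
  unique-xxx i≢j i≢k j≢k = unique₃ (x-≢ i≢j) (x-≢ i≢k) (x-≢ j≢k)

  -- By `distinct`, an equality between two of these pair variables would make two of the indices
  -- coincide.
  unique-eee : ∀ {i j k} → i ≢ j → i ≢ k → j ≢ k → Unique (e i j ∷ e j k ∷ e i k ∷ [])
  unique-eee i≢j i≢k j≢k = unique₃
    ([ i≢j ∘ proj₁ , i≢k ∘ proj₁ ]′ ∘ distinct i≢j j≢k)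
    ([ j≢k ∘ proj₂ , i≢k ∘ proj₁ ]′ ∘ distinct i≢j i≢k)
    ([ i≢j ∘ sym ∘ proj₁ , j≢k ∘ proj₁ ]′ ∘ distinct j≢k i≢k)

  <-≢₃ : ∀ {i j k : Fin m} → i < j → j < k → i ≢ j × i ≢ k × j ≢ k
  <-≢₃ i<j j<k = Fin.<⇒≢ i<j , Fin.<⇒≢ (Fin.<-trans i<j j<k) , Fin.<⇒≢ j<k

  ∈-triples⁺ : ∀ {i j k} → i < j → j < k → (i , j , k) ∈ triples m
  ∈-triples⁺ {i} {j} {k} i<j j<k =
    ∈-filter⁺ _ (∈-cartesianProduct⁺ (∈-allFin i) (∈-cartesianProduct⁺ (∈-allFin j) (∈-allFin k))) (i<j , j<k)

  ∈-triples⁻ : ∀ {i j k} → (i , j , k) ∈ triples m → i ≢ j × i ≢ k × j ≢ k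
  ∈-triples⁻ t∈ =
    let i<j , j<k = proj₂ (∈-filter⁻ (λ (i , j , k) → (i <? j) ×-dec (j <? k))
                         {xs = cartesianProduct (allFin m) (cartesianProduct (allFin m) (allFin m))} t∈)
    in <-≢₃ i<j j<k

  private
    clauseTriple? = λ (((i , j , k) , p) : (Fin m × Fin m × Fin m) × Bool) →
      (var (x i) ∷ var (x j) ∷ var (x k) ∷ [] ≐ p) ∈ᶠ? φ

  -- The index list inside `Eq`, named so that membership in it can be stated.
  clauseTriples : List ((Fin m × Fin m × Fin m) × Bool)
  clauseTriples = filter clauseTriple? (cartesianProduct (triples m) (false ∷ true ∷ []))

  ∈-clauseTriples⁺ : ∀ {i j k p} → i < j → j < k → Occurs (x i ∷ x j ∷ x k ∷ []) p φ →
    ((i , j , k) , p) ∈ clauseTriples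
  ∈-clauseTriples⁺ {p = p} i<j j<k o =
    let i≢j , i≢k , j≢k = <-≢₃ i<j j<k in
    ∈-filter⁺ clauseTriple? (∈-cartesianProduct⁺ (∈-triples⁺ i<j j<k) (p∈ p))
      (occurs-resp (∼-reflexive (vars-≐ [] p (unique-xxx i≢j i≢k j≢k))) o)
    where
    p∈ : ∀ p → p ∈ false ∷ true ∷ []
    p∈ false = here refl
    p∈ true  = there (here refl)

  ∈-clauseTriples⁻ : ∀ {i j k p} → ((i , j , k) , p) ∈ clauseTriples →
    (i ≢ j × i ≢ k × j ≢ k) × Occurs (x i ∷ x j ∷ x k ∷ []) p φ
  ∈-clauseTriples⁻ {p = p} t∈ =
    let t∈′ , o = ∈-filter⁻ clauseTriple? {xs = cartesianProduct (triples m) (false ∷ true ∷ [])} t∈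
        i≢j , i≢k , j≢k = ∈-triples⁻ (proj₁ (∈-cartesianProduct⁻ (triples m) _ t∈′))
    in (i≢j , i≢k , j≢k) , occurs-resp (∼-reflexive (sym (vars-≐ [] p (unique-xxx i≢j i≢k j≢k)))) o

  clause∈Eq : ∀ {i j k p} → i < j → j < k → Occurs (x i ∷ x j ∷ x k ∷ []) p φ →
    All (_∈ Eq x e φ)
      ( (var (e i j) ∷ var (x k) ∷ con true ∷ [] ≐ p)
      ∷ (var (e i k) ∷ var (x j) ∷ con true ∷ [] ≐ p)
      ∷ (var (x i) ∷ var (e j k) ∷ con true ∷ [] ≐ p) ∷ [])
  clause∈Eq i<j j<k o = All.tabulate λ C∈ →
    ∈-++⁺ˡ (∈-concatMap⁺ _ (lose (∈-clauseTriples⁺ i<j j<k o) C∈))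

  transitivity∈Eq : ∀ {i j k} → i < j → j < k →
    (var (e i j) ∷ var (e j k) ∷ var (e i k) ∷ [] ≐ true) ∈ Eq x e φ
  transitivity∈Eq i<j j<k = ∈-++⁺ʳ _ (∈-map⁺ _ (∈-triples⁺ i<j j<k))

  -- Extending a model of `φ` to the pair variables.

  module Models (τ : Assignment) where

    extended : Assignment
    extended v with v ∈? varsᶠ φ
    ... | yes _ = τ v
    ... | no  _ with Fin.any? (λ i → Fin.any? (λ j → ¬? (i Fin.≟ j) ×-dec (v ≟ e i j)))
    ...   | yes (i , j , _) = not (τ (x i) xor τ (x j))
    -- An arbitrary default: such a variable occurs neither in `φ` nor in `Eq x e φ`.
    ...   | no  _           = false

    extended-old : ∀ {v} → v ∈ varsᶠ φ → extended v ≡ τ v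
    extended-old {v} v∈ with v ∈? varsᶠ φ
    ... | yes _  = refl
    ... | no  v∉ = contradiction v∈ v∉

    extended-e : ∀ {i j} → i ≢ j → extended (e i j) ≡ not (τ (x i) xor τ (x j))
    extended-e {i} {j} i≢j with e i j ∈? varsᶠ φ
    ... | yes e∈ = contradiction e∈ (new i≢j)
    ... | no  _ with Fin.any? (λ k → Fin.any? (λ l → ¬? (k Fin.≟ l) ×-dec (e i j ≟ e k l)))
    ...   | no  none = contradiction (i , j , i≢j , refl) none
    ...   | yes (k , l , k≢l , eq) with distinct i≢j k≢l eq
    ...     | inj₁ (refl , refl) = refl
    -- The search may find the pair in the opposite order; the assigned value is symmetric.
    ...     | inj₂ (refl , refl) = cong not (xor-comm (τ (x k)) (τ (x l)))

    -- Both sides equal ⊤ ⊕ `τ (x i)` ⊕ `τ (x j)` ⊕ `τ (x k)`. The right-hand side is `not p`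
    -- because normalisation moves the constant ⊤ of the defining clause across.
    ⨁-ex : ∀ {i j k p} → i ≢ j → i ≢ k → j ≢ k → τ ⊨ᶠ φ → Occurs (x i ∷ x j ∷ x k ∷ []) p φ →
      ⨁ (map extended (e i j ∷ x k ∷ [])) ≡ not p
    ⨁-ex {i} {j} {k} i≢j i≢k j≢k τ⊨ o
      rewrite extended-e i≢j | extended-old (x∈ k) | sym (⊨-occurs (unique-xxx i≢j i≢k j≢k) τ⊨ o) =
      solve 3 (λ a b c → (con true :+ (a :+ b)) :+ (c :+ con false) :=
                         con true :+ (a :+ (b :+ (c :+ con false)))) refl (τ (x i)) (τ (x j)) (τ (x k))
      where open xor-∧-Solver

    -- Each of the three original values occurs twice and cancels, leaving ⊤ ⊕ ⊤ ⊕ ⊤.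
    ⨁-eee : ∀ {i j k} → i ≢ j → i ≢ k → j ≢ k → ⨁ (map extended (e i j ∷ e j k ∷ e i k ∷ [])) ≡ true
    ⨁-eee {i} {j} {k} i≢j i≢k j≢k
      rewrite extended-e i≢j | extended-e i≢k | extended-e j≢k with τ (x i) | τ (x j) | τ (x k)
    ... | false | false | false = refl
    ... | false | false | true  = refl
    ... | false | true  | false = refl
    ... | false | true  | true  = refl
    ... | true  | false | false = refl
    ... | true  | false | true  = refl
    ... | true  | true  | false = refl
    ... | true  | true  | true  = refl

    extended⊨φ : τ ⊨ᶠ φ → extended ⊨ᶠ φ
    extended⊨φ τ⊨ = All.tabulate λ {C} C∈ →
      trans (cong ⨁ (map-cong-local (All.tabulate λ v∈ → extended-old (occurs-vars (∈⇒∈ᶠ C∈) v∈))))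
            (All.lookup τ⊨ C∈)

    extended⊨Eq : τ ⊨ᶠ φ → extended ⊨ᶠ Eq x e φ
    extended⊨Eq τ⊨ = All.++⁺
      (All.concat⁺ (All.map⁺ (All.tabulate {xs = clauseTriples} λ {((i , j , k) , p)} t∈ →
        let (i≢j , i≢k , j≢k) , o = ∈-clauseTriples⁻ t∈
        in ⊨-≐ [ true ] p (unique-ex i≢j) (⨁-ex i≢j i≢k j≢k τ⊨ o)
         ∷ ⊨-≐ [ true ] p (unique-ex i≢k)
             (⨁-ex i≢k i≢j (≢-sym j≢k) τ⊨ (occurs-resp (↭⇒∼set (prep _ (swap _ _ ↭-refl))) o))
         -- This conjunct lists the original variable first, so the sum is reversed before `⨁-ex`
         -- applies to `j`, `k`, `i`.
         ∷ ⊨-≐ [ true ] p (unique-xe j≢k)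
             (trans (⨁-↭ (map⁺ extended (↭-reverse (e j k ∷ x i ∷ []))))
                    (⨁-ex j≢k (≢-sym i≢j) (≢-sym i≢k) τ⊨ (occurs-resp (↭⇒∼set (shift (x i) (x j ∷ x k ∷ []) [])) o)))
         ∷ [])))
      (All.map⁺ (All.tabulate {xs = triples m} λ {(i , j , k)} t∈ →
        let i≢j , i≢k , j≢k = ∈-triples⁻ t∈ in
        ⊨-≐ [] true (unique-eee i≢j i≢k j≢k) (⨁-eee i≢j i≢k j≢k)))

    same-models : τ ⊨ᶠ φ ⇔ (∃[ τ′ ] (τ′ ⊨ᶠ φ ++ Eq x e φ × (∀ v → v ∈ varsᶠ φ → τ′ v ≡ τ v)))
    same-models = mk⇔
      (λ τ⊨ → extended , All.++⁺ (extended⊨φ τ⊨) (extended⊨Eq τ⊨) , λ _ → extended-old)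
      (λ (τ′ , τ′⊨ , agree) → All.tabulate λ {C} C∈ →
        trans (cong ⨁ (map-cong-local (All.tabulate λ v∈ → sym (agree _ (occurs-vars (∈⇒∈ᶠ C∈) v∈)))))
              (All.lookup (All.++⁻ˡ φ τ′⊨) C∈))

  -- Clauses of `Eq` for indices in any order.

  module Propagation (ls : List Literal) where

    open UnitPropagation ((φ ++ Eq x e φ) ++ map lit ls)

    U-φ : ∀ {xs p} → Occurs xs p φ → U xs p
    U-φ o = U-axiom (Any.++⁺ˡ (Any.++⁺ˡ o))

    U-Eq : ∀ {C xs} → C ∈ Eq x e φ → vars C ≡ xs → U xs (rhs C)
    U-Eq C∈ = U-clause (∈-++⁺ˡ (∈-++⁺ʳ φ C∈))

    U-e-comm : ∀ {i j p} → U [ e i j ] p → U [ e j i ] p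
    U-e-comm {i} {j} = subst (λ v → U [ v ] _) (e-sym i j)

    private
      -- The three defining clauses are kept together because exchanging two indices permutes them;
      -- no single one of them is preserved by both exchanges.
      Definitions : Fin m → Fin m → Fin m → Set
      Definitions i j k = ∀ {p} → Occurs (x i ∷ x j ∷ x k ∷ []) p φ →
        U (e i j ∷ x k ∷ []) (not p) × U (e i k ∷ x j ∷ []) (not p) × U (e j k ∷ x i ∷ []) (not p)

    U-definition : ∀ {i j k p} → i ≢ j → i ≢ k → j ≢ k → Occurs (x i ∷ x j ∷ x k ∷ []) p φ →
      U (e i j ∷ x k ∷ []) (not p)
    U-definition i≢j i≢k j≢k o = proj₁ (reorder-increasing Definitions
      (λ {i} {j} d o → let a , b , c = d (occurs-resp (↭⇒∼set (swap _ _ ↭-refl)) o) in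
        subst (λ v → U (v ∷ _) _) (e-sym i j) a , c , b)
      (λ {i} {j} {k} d o → let a , b , c = d (occurs-resp (↭⇒∼set (prep _ (swap _ _ ↭-refl))) o) in
        b , a , subst (λ v → U (v ∷ _) _) (e-sym j k) c)
      (λ {i} {j} {k} i<j j<k {p} o → let i≢j , i≢k , j≢k = <-≢₃ i<j j<k in case clause∈Eq i<j j<k o of λ
        { (c₁ ∷ c₂ ∷ c₃ ∷ []) →
          U-Eq c₁ (vars-≐ [ true ] p (unique-ex i≢j)) ,
          U-Eq c₂ (vars-≐ [ true ] p (unique-ex i≢k)) ,
          U-resp (↭⇒∼set (swap _ _ ↭-refl)) (U-Eq c₃ (vars-≐ [ true ] p (unique-xe j≢k))) })
      i≢j i≢k j≢k o)

    U-transitivity : ∀ {i j k} → i ≢ j → i ≢ k → j ≢ k → U (e i j ∷ e j k ∷ e i k ∷ []) true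
    U-transitivity = reorder-increasing (λ i j k → U (e i j ∷ e j k ∷ e i k ∷ []) true)
      (λ {i} {j} {k} u → subst (λ v → U (v ∷ e i k ∷ e j k ∷ []) true) (e-sym i j)
        (U-resp (↭⇒∼set (prep _ (swap _ _ ↭-refl))) u))
      (λ {i} {j} {k} u → subst (λ v → U (e i k ∷ v ∷ e i j ∷ []) true) (e-sym j k)
        (U-resp (↭⇒∼set (↭-reverse (e i j ∷ e j k ∷ e i k ∷ []))) u))
      (λ i<j j<k → let i≢j , i≢k , j≢k = <-≢₃ i<j j<k in
        U-Eq (transitivity∈Eq i<j j<k) (vars-≐ [] true (unique-eee i≢j i≢k j≢k)))

    -- Paths of two-variable equations and the invariant of EC derivations.

    data Linked (v w : V) (p : Bool) : Set where
      linked : ∀ {i j} → i ≢ j → v ≡ x i → w ≡ x j → U [ e i j ] (not p) → Linked v w p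

    -- The two known literals are propagated through the transitivity clause, which leaves a literal
    -- on `e i k`. The condition `u ≢ w` gives `i ≢ k`, as that clause requires.
    linked-trans : ∀ {u v w a b} → u ≢ w → Linked u v a → Linked v w b → Linked u w (a xor b)
    linked-trans {a = a} {b} u≢w (linked {i} {j} i≢j refl refl uᵢⱼ) (linked {j′} {k} j≢k eq refl uⱼₖ)
      with injective eq
    ... | refl = linked i≢k refl refl (subst (U [ e i k ]) (parity a b)
        (propagate (All.All¬⇒¬Any (AllPairs.head (AllPairs.tail u))) uⱼₖ
          (propagate (All.All¬⇒¬Any (AllPairs.head u)) uᵢⱼ (U-transitivity i≢j i≢k j≢k))))
      where
      i≢k : i ≢ k
      i≢k = u≢w ∘ cong x
      u = unique-eee i≢j i≢k j≢k
      parity : ∀ a b → not b xor (not a xor true) ≡ not (a xor b)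
      parity false false = refl
      parity false true  = refl
      parity true  false = refl
      parity true  true  = refl

    -- The path has at least one edge, since linked variables have distinct indices. Injectivity of
    -- `y` keeps the two ends distinct at every contraction.
    linked-path : ∀ {k} (y : Vector V (suc (suc k))) (c : Vector Bool (suc k)) → Injective _≡_ _≡_ y →
      (∀ i → Linked (y (inject₁ i)) (y (suc i)) (c i)) →
      Linked (y zero) (y (fromℕ (suc k))) (⨁ (Vector.toList c))
    linked-path {ℕ.zero} y c inj link = subst (Linked _ _) (sym (xor-identityʳ (c zero))) (link zero)
    linked-path {suc k}  y c inj link =
      linked-trans (λ eq → case inj eq of λ ()) (link zero)
        (linked-path (y ∘ suc) (c ∘ suc) (Fin.suc-injective ∘ inj) (link ∘ suc))

    -- The case `empty` carries no UP derivation: no EC rule has the empty clause as a premise, and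
    -- only literals have to be simulated.
    data Simulated (xs : List V) (p : Bool) : Set where
      original : Occurs xs p φ → Simulated xs p
      empty    : xs ∼[ set ] [] → Simulated xs p
      unit     : ∀ {v} → xs ∼[ set ] [ v ] → U [ v ] p → Simulated xs p
      pair     : ∀ {v w} → v ≢ w → xs ∼[ set ] v ∷ w ∷ [] → U (v ∷ w ∷ []) p → Linked v w p → Simulated xs p

    simulated-resp : ∀ {xs ys p} → ys ∼[ set ] xs → Simulated xs p → Simulated ys p
    simulated-resp eq (original o)      = original (occurs-resp eq o)
    simulated-resp eq (empty s)         = empty (∼-trans eq s)
    simulated-resp eq (unit s u)        = unit (∼-trans eq s) u
    simulated-resp eq (pair v≢w s u l) = pair v≢w (∼-trans eq s) u l

    -- The cases of `Simulated` have three, zero, one and two variables respectively, so counting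
    -- variables tells which case a premise falls under.
    length-≡ : ∀ {xs ys : List V} → Unique xs → Unique ys → xs ∼[ set ] ys → length xs ≡ length ys
    length-≡ u v s = ↭-length (unique∧set⇒↭ u v s)

    length-original : ∀ {xs p} → Unique xs → Occurs xs p φ → length xs ≡ 3
    length-original u o with find o
    ... | C , C∈ , s , _ = trans (length-≡ u (unique C) s) (three-vars {C} (∈⇒∈ᶠ C∈))

    simulated₁ : ∀ {v p} → Simulated [ v ] p → U [ v ] p
    simulated₁ (original o)     = case length-original ([] ∷ []) o of λ ()
    simulated₁ (empty s)        = case length-≡ ([] ∷ []) [] s of λ ()
    simulated₁ (unit s u)       = U-resp s u
    simulated₁ (pair v≢w s _ _) = case length-≡ ([] ∷ []) (unique₂ v≢w) s of λ ()

    simulated₂ : ∀ {v w p} → Unique (v ∷ w ∷ []) → Simulated (v ∷ w ∷ []) p → U (v ∷ w ∷ []) p × Linked v w p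
    simulated₂ uniq (original o)     = case length-original uniq o of λ ()
    simulated₂ uniq (empty s)        = case length-≡ uniq [] s of λ ()
    simulated₂ uniq (unit s _)       = case length-≡ uniq ([] ∷ []) s of λ ()
    simulated₂ uniq@((v≢w ∷ []) ∷ _) (pair _ s u l@(linked i≢j refl refl uₑ)) =
      U-resp s u ,
      -- The recorded pair may list the two variables in either order; the reversed one is handled
      -- by the symmetry of `e`.
      (case Equivalence.to s (here refl) , Equivalence.to s (there (here refl)) of λ
        { (here refl , here refl)                 → contradiction refl v≢w
        ; (here refl , there (here refl))         → l
        ; (there (here refl) , here refl)         → linked (≢-sym i≢j) refl refl (U-e-comm uₑ)
        ; (there (here refl) , there (here refl)) → contradiction refl v≢w })

    simulated₃ : ∀ {u v w p} → Unique (u ∷ v ∷ w ∷ []) → Simulated (u ∷ v ∷ w ∷ []) p →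
      Occurs (u ∷ v ∷ w ∷ []) p φ
    simulated₃ uniq (original o)     = o
    simulated₃ uniq (empty s)        = case length-≡ uniq [] s of λ ()
    simulated₃ uniq (unit s _)       = case length-≡ uniq ([] ∷ []) s of λ ()
    simulated₃ uniq (pair v≢w s _ _) = case length-≡ uniq (unique₂ v≢w) s of λ ()

    -- All variables of a clause of `φ` are some `x i`. The inequality `e i j ≢ w` is what lets
    -- `propagate` eliminate either variable of the defining clause.
    U-pair : ∀ {u v w p} → Unique (u ∷ v ∷ w ∷ []) → Occurs (u ∷ v ∷ w ∷ []) p φ →
      ∃[ i ] ∃[ j ] (i ≢ j × u ≡ x i × v ≡ x j × e i j ≢ w × U (e i j ∷ w ∷ []) (not p))
    U-pair ((u≢v ∷ u≢w ∷ []) ∷ (v≢w ∷ []) ∷ _) o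
      with index (occurs-vars o (here refl)) | index (occurs-vars o (there (here refl)))
         | index (occurs-vars o (there (there (here refl))))
    ... | i , refl | j , refl | k , refl =
      i , j , i≢j , refl , refl , e≢x i≢j , U-definition i≢j (u≢w ∘ cong x) (v≢w ∘ cong x) o
      where
      i≢j : i ≢ j
      i≢j = u≢v ∘ cong x

    -- Preservation of the invariant by the EC rules.

    Sound : List XorClause → Set
    Sound Γ = ∀ {xs p} → Occurs xs p Γ → Simulated xs p

    displayed : ∀ {Γ xs} p → Sound Γ → Unique xs → Occurs (vars (map var xs ++ [] ≐ p)) p Γ → Simulated xs p
    displayed p sound u o = sound (occurs-resp (∼-reflexive (sym (vars-≐ [] p u))) o)

    step : ∀ {Γ C} → Sound Γ → EC Γ C → Simulated (vars C) (rhs C)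
    step sound (conflict _ _) = empty ∼-refl
    step sound (unit₂ {b = b} l (uniq@((x≢y ∷ []) ∷ _) , o)) = unit ∼-refl
      (propagate (All.All¬⇒¬Any (x≢y ∷ [])) (simulated₁ (sound l))
        (proj₁ (simulated₂ uniq (displayed b sound uniq o))))
    step sound (unit₃ {a = a} {b} l (uniq@(x∉ ∷ uniq′@((y≢z ∷ []) ∷ _)) , o))
      with simulated₃ uniq (displayed b sound uniq o)
    -- The clause is rotated so that its last variable is the one being assigned. The defining
    -- clause then pairs that variable with the `e` of the remaining two.
    ... | oφ with U-pair (unique-rotate uniq) (occurs-resp (↭⇒∼set (shift _ (_ ∷ _ ∷ []) [])) oφ)
    ...   | i , j , i≢j , y≡ , z≡ , e≢ , uₑ =
      pair y≢z (∼-reflexive (vars-≐ [] (a xor b) uniq′))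
        -- The same literal is propagated twice: through the clause of `φ` for the equation on `y`
        -- and `z`, and through the defining clause for the literal on `e i j`.
        (propagate (All.All¬⇒¬Any x∉) (simulated₁ (sound l)) (U-φ oφ))
        (linked i≢j y≡ z≡ (subst (U [ e i j ]) (sym (not-distribʳ-xor a b))
          (propagate (λ { (here eq) → e≢ (sym eq) }) (simulated₁ (sound l))
            (U-resp (↭⇒∼set (swap _ _ ↭-refl)) uₑ))))
    step sound (eqv-imply {ℕ.zero} y c inj links ((y≢y ∷ _) ∷ _ , _)) = contradiction refl y≢y
    step sound (eqv-imply {suc k} y c {z} {d} inj links (uniq , o))
      with U-pair uniq (simulated₃ uniq (displayed d sound uniq o))
         | linked-path y c inj (λ i → let u , o = links i in
             proj₂ (simulated₂ u (displayed (c i) sound u o)))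
    ... | i , j , i≢j , eqᵢ , eqⱼ , e≢ , uₑ | linked _ eqᵢ′ eqⱼ′ uₗ
      with injective (trans (sym eqᵢ) eqᵢ′) | injective (trans (sym eqⱼ) eqⱼ′)
    -- The closing clause and the collapsed path now speak of the same `e i j`, and the negations in
    -- their two right-hand sides cancel.
    ... | refl | refl = unit ∼-refl (subst (U [ z ]) (xor-annihilates-not (⨁ (Vector.toList c)) d)
        (propagate (λ { (here eq) → e≢ eq }) uₗ uₑ))
    step sound (eqv-conflict _ _ _ _ _ _) = empty ∼-refl

    sound : ∀ {Γ} → Derivation EC (φ ++ map lit ls) Γ → Sound Γ
    sound (_      ∷ d) (there o)         = sound d o
    sound (inj₂ r ∷ d) (here (s , refl)) = simulated-resp s (step (sound d) r)
    sound (inj₁ C∈ ∷ d) (here (s , refl)) with Any.++⁻ φ (occurs-resp s C∈)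
    ... | inj₁ o = original o
    ... | inj₂ o with find o
    ...   | _ , l∈ , s′ , refl with ∈-map⁻ lit l∈
    -- An assumed literal is itself a clause of the formula on the UP side.
    ...     | _ , _ , refl = unit s′ (U-clause (∈-++⁺ʳ (φ ++ Eq x e φ) l∈) refl)

    simulates : ∀ l → Derivable EC (φ ++ map lit ls) (lit l) →
      Derivable UP ((φ ++ Eq x e φ) ++ map lit ls) (lit l)
    simulates _ (_ , d , o) = simulated₁ (sound d o)

-- Both conditions on an EC-simulation formula combined.

theorem4 : {V : Set} (_≟_ : DecidableEquality V) → let open XorLogic _≟_ in
    (φ : Formula) → 3XorNF φ →
    (m : ℕ) (x : Fin m → V) → EnumeratesVars x φ →
    (e : Fin m → Fin m → V) → FreshPairVars e φ →
    ECSimulation φ (Eq x e φ)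
theorem4 _≟_ φ nf m x enum e fresh = record
  { same-models = S.Models.same-models
  ; simulates   = λ ls _ → S.Propagation.simulates ls
  }
  where module S = Simulation _≟_ φ nf x enum e fresh
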